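{- Let $P=\Delta^1\times\Delta^1\times\Delta^2$ (the product of a square and a triangle). The minimal size of a cover of $P$ is $10$ simplices, and there is a triangulation of $P$ (using only vertices of $P$) with $10$ simplices.
   Context: $\Delta^d$ is the convex hull of the standard unit vectors of $\mathbb{R}^{d+1}$; $P$ is a $4$-dimensional polytope with $12$ vertices. A cover of $P$ is a collection of $4$-simplices, each spanned by vertices of $P$, whose union is $P$. A triangulation is a decomposition into $4$-simplices meeting face-to-face.
   Formalization: The points of the polytope P and of the simplices, and the coefficients in convex hulls and affine independence, are rational rather than real; covering and meeting face-to-face are thus stated for rational points only. -}

module Defs where

open import Data.Nat using (ℕ; zero; suc)
open import Data.Bool using (if_then_else_)
open import Data.Fin using (Fin; zero; suc; remQuot; _≟_)
open import Data.Fin.Subset using (Subset; _∈_; _∉_; _∩_; ∣_∣)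
open import Data.Rational using (ℚ; 0ℚ; 1ℚ; _+_; _*_; _≤_)
open import Data.Product using (_×_; _,_; proj₁; proj₂; Σ; Σ-syntax; ∃)
open import Data.List using (List)
open import Data.List.Membership.Propositional using () renaming (_∈_ to _∈ₗ_)
open import Data.List.Relation.Unary.AllPairs using (AllPairs)
open import Relation.Nullary using (¬_)
open import Relation.Nullary.Decidable using (⌊_⌋)
open import Relation.Binary.PropositionalEquality using (_≡_; _≢_)

sumℚ : ∀ {n} → (Fin n → ℚ) → ℚ
sumℚ {zero}  f = 0ℚ
sumℚ {suc n} f = f zero + sumℚ (λ i → f (suc i))

δ : ∀ {n} → Fin n → Fin n → ℚ
δ i j = if ⌊ i ≟ j ⌋ then 1ℚ else 0ℚ

Point : Set
Point = (Fin 2 → ℚ) × (Fin 2 → ℚ) × (Fin 3 → ℚ)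

InStdSimplex : ∀ {n} → (Fin n → ℚ) → Set
InStdSimplex {n} a = (∀ i → 0ℚ ≤ a i) × sumℚ a ≡ 1ℚ

InP : Point → Set
InP (a , b , c) = InStdSimplex a × InStdSimplex b × InStdSimplex c

decode : Fin 12 → Fin 2 × Fin 2 × Fin 3
decode v with remQuot {2} 6 v
... | (i , r) with remQuot {2} 3 r
... | (j , k) = i , j , k

vertex : Fin 12 → Point
vertex v with decode v
... | (i , j , k) = δ i , δ j , δ k

IsCombination : (Fin 12 → ℚ) → Point → Set
IsCombination λs (a , b , c) =
    (∀ t → sumℚ (λ v → λs v * proj₁ (vertex v) t) ≡ a t)
  × (∀ t → sumℚ (λ v → λs v * proj₁ (proj₂ (vertex v)) t) ≡ b t)
  × (∀ t → sumℚ (λ v → λs v * proj₂ (proj₂ (vertex v)) t) ≡ c t)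

SupportedOn : (Fin 12 → ℚ) → Subset 12 → Set
SupportedOn λs S = ∀ v → v ∉ S → λs v ≡ 0ℚ

InConv : Subset 12 → Point → Set
InConv S x = Σ[ λs ∈ (Fin 12 → ℚ) ]
    (∀ v → 0ℚ ≤ λs v) × SupportedOn λs S × sumℚ λs ≡ 1ℚ × IsCombination λs x

AffinelyIndependent : Subset 12 → Set
AffinelyIndependent S = ∀ (μ : Fin 12 → ℚ) → SupportedOn μ S → sumℚ μ ≡ 0ℚ →
  IsCombination μ (( λ _ → 0ℚ) , (λ _ → 0ℚ) , (λ _ → 0ℚ)) → ∀ v → μ v ≡ 0ℚ

record Simplex4 : Set where
  field
    verts : Subset 12
    card5 : ∣ verts ∣ ≡ 5
    affInd : AffinelyIndependent verts
open Simplex4 public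

-- A cover of P: union of the simplices equals P (tested on rational points).
IsCover : List Simplex4 → Set
IsCover C = (∀ x → InP x → Σ[ σ ∈ Simplex4 ] (σ ∈ₗ C × InConv (verts σ) x))
          × (∀ σ → σ ∈ₗ C → ∀ x → InConv (verts σ) x → InP x)

FaceToFace : List Simplex4 → Set
FaceToFace T = ∀ σ τ → σ ∈ₗ T → τ ∈ₗ T → ∀ x →
  InConv (verts σ) x → InConv (verts τ) x → InConv (verts σ ∩ verts τ) x

IsTriangulation : List Simplex4 → Set
IsTriangulation T = IsCover T × AllPairs (λ σ τ → verts σ ≢ verts τ) T × FaceToFace T

{-# OPTIONS --safe #-}
-- Lower bound: there are ten points of P no two of which lie in a common
-- simplex, so a cover needs ten simplices.  If a linear form is positive at a
-- point of conv S, then it is positive at some vertex in S; for ten well-chosen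
-- points and a few forms for each, no set of five vertices satisfies these
-- conditions for two of the points.
--
-- Triangulation: lift the vertices to integer heights and project the lower
-- hull.  Its ten pieces are graphs of linear forms, and x lies in the simplex
-- whose form is largest at x, because each barycentric coordinate is either a
-- coordinate of x or a positive multiple of the difference of two of the forms.
-- Where two simplices meet their forms agree, so no weight sits on a vertex
-- whose height exceeds either form: the intersection is a common face.
module Submission where

open import Defs
open import Algebra.Bundles using (module CommutativeRing)
open import Data.Bool using (Bool; if_then_else_)
import Data.Bool.Properties as Bool
open import Data.Empty using (⊥; ⊥-elim)
open import Data.Fin using (Fin; zero; suc; _≟_; _↑ˡ_; _↑ʳ_; combine; remQuot; splitAt; opposite; punchIn) renaming (_<_ to _<ᶠ_; _<?_ to _<ᶠ?_)
open import Data.Fin.Patterns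
open import Data.Fin.Properties using (any?; all?; remQuot-combine; pigeonhole)
open import Data.Fin.Subset using (Subset; _∈_; _∉_; _∩_; ∣_∣; Nonempty; inside; outside)
open import Data.Fin.Subset.Properties using (_∈?_; x∈p∩q⁺; nonempty?; anySubset?)
import Data.Integer as ℤ
open import Data.List as List using (List; []; _∷_; allFin; length)
open import Data.List.Membership.Propositional using () renaming (_∈_ to _∈ₗ_)
open import Data.List.Membership.Propositional.Properties using (∈-allFin; ∈-tabulate⁺; ∈-tabulate⁻)
open import Data.List.Relation.Unary.All as All using (All)
import Data.List.Relation.Unary.All.Properties as All
import Data.List.Relation.Unary.AllPairs.Properties as AllPairs
open import Data.List.Relation.Unary.Any using (index)
open import Data.List.Relation.Unary.Any.Properties using (lookup-index)
open import Data.Nat as ℕ using (ℕ; _≤_)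
import Data.Nat.Properties as ℕ
open import Data.Product using (_×_; _,_; ∃; proj₁; proj₂; Σ-syntax)
open import Data.Rational using (ℚ; 0ℚ; 1ℚ; ½; _+_; _*_; _-_; -_; _/_; _<_; nonNegative; positive) renaming (_≤_ to _≤ℚ_)
open import Data.Rational.Properties as ℚ using (_≤?_; _<?_)
open import Data.Rational.Solver using (module +-*-Solver)
open import Data.Sum using (_⊎_; inj₁; inj₂; [_,_]′)
open import Data.Vec as Vec using (Vec; []; _∷_; lookup; tabulate)
open import Data.Vec.Properties using (lookup-map; lookup∘tabulate; lookup⇒[]=; ≡-dec)
open import Function using (_∘_)
open import Relation.Binary.Bundles using (module DecTotalOrder)
open import Relation.Binary.PropositionalEquality using (_≡_; _≢_; refl; sym; trans; cong; cong₂; subst; module ≡-Reasoning)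
open import Relation.Nullary using (Dec; yes; no; does; ¬_; contradiction; ¬?)
open import Relation.Nullary.Decidable using (from-yes; from-no; dec-true; _×-dec_; _⊎-dec_; _→-dec_)
open import Algebra.Properties.Semiring.Sum (CommutativeRing.semiring ℚ.+-*-commutativeRing) as Sum using (sum)
open import Data.List.Extrema (DecTotalOrder.totalOrder ℚ.≤-decTotalOrder) using (argmax; f[xs]≤f[argmax])
open ≡-Reasoning

-- Finite sums

0≤1 : 0ℚ ≤ℚ 1ℚ
0≤1 = from-yes (0ℚ ≤? 1ℚ)

*-nonNeg : ∀ {p q} → 0ℚ ≤ℚ p → 0ℚ ≤ℚ q → 0ℚ ≤ℚ p * q
*-nonNeg {p} {q} 0≤p 0≤q = subst (_≤ℚ p * q) (ℚ.*-zeroʳ p)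
  (ℚ.*-monoˡ-≤-nonNeg p {{nonNegative 0≤p}} 0≤q)

-- Links the recursive sum to the semiring sum of the library, from which congruence, distributivity
-- and interchange are transported.
sumℚ≡sum : ∀ {n} (f : Fin n → ℚ) → sumℚ f ≡ sum f
sumℚ≡sum {ℕ.zero}  f = refl
sumℚ≡sum {ℕ.suc n} f = cong (f zero +_) (sumℚ≡sum (f ∘ suc))

sumℚ-cong : ∀ {n} {f g : Fin n → ℚ} → (∀ i → f i ≡ g i) → sumℚ f ≡ sumℚ g
sumℚ-cong {f = f} {g} f≗g = trans (sumℚ≡sum f) (trans (Sum.sum-cong-≗ f≗g) (sym (sumℚ≡sum g)))

sumℚ-zero : ∀ n → sumℚ {n} (λ _ → 0ℚ) ≡ 0ℚ
sumℚ-zero n = trans (sumℚ≡sum {n} _) (Sum.sum-replicate-zero n)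

sumℚ-*ˡ : ∀ {n} c (f : Fin n → ℚ) → sumℚ (λ i → c * f i) ≡ c * sumℚ f
sumℚ-*ˡ c f = trans (sumℚ≡sum (λ i → c * f i)) (trans (sym (Sum.*-distribˡ-sum c f)) (cong (c *_) (sym (sumℚ≡sum f))))

sumℚ-*ʳ : ∀ {n} c (f : Fin n → ℚ) → sumℚ (λ i → f i * c) ≡ sumℚ f * c
sumℚ-*ʳ c f = trans (sumℚ≡sum (λ i → f i * c)) (trans (sym (Sum.*-distribʳ-sum c f)) (cong (_* c) (sym (sumℚ≡sum f))))

sumℚ-comm : ∀ {m n} (f : Fin m → Fin n → ℚ) →
  sumℚ (λ i → sumℚ (f i)) ≡ sumℚ (λ j → sumℚ (λ i → f i j))
sumℚ-comm f = begin
  sumℚ (λ i → sumℚ (f i))        ≡⟨ sumℚ-cong (sumℚ≡sum ∘ f) ⟩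
  sumℚ (λ i → sum (f i))         ≡⟨ sumℚ≡sum (λ i → sum (f i)) ⟩
  sum (λ i → sum (f i))          ≡⟨ Sum.∑-comm f ⟩
  sum (λ j → sum (λ i → f i j))  ≡⟨ sumℚ≡sum (λ j → sum (λ i → f i j)) ⟨
  sumℚ (λ j → sum (λ i → f i j)) ≡⟨ sumℚ-cong (λ j → sumℚ≡sum (λ i → f i j)) ⟨
  sumℚ (λ j → sumℚ (λ i → f i j)) ∎

sumℚ-mono : ∀ {n} {f g : Fin n → ℚ} → (∀ i → f i ≤ℚ g i) → sumℚ f ≤ℚ sumℚ g
sumℚ-mono {ℕ.zero}  f≤g = ℚ.≤-refl
sumℚ-mono {ℕ.suc n} f≤g = ℚ.+-mono-≤ (f≤g zero) (sumℚ-mono (f≤g ∘ suc))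

sumℚ-nonNeg : ∀ {n} {f : Fin n → ℚ} → (∀ i → 0ℚ ≤ℚ f i) → 0ℚ ≤ℚ sumℚ f
sumℚ-nonNeg {n} {f} 0≤f = subst (_≤ℚ sumℚ f) (sumℚ-zero n) (sumℚ-mono 0≤f)

sumℚ-nonPos : ∀ {n} {f : Fin n → ℚ} → (∀ i → f i ≤ℚ 0ℚ) → sumℚ f ≤ℚ 0ℚ
sumℚ-nonPos {n} {f} f≤0 = subst (sumℚ f ≤ℚ_) (sumℚ-zero n) (sumℚ-mono f≤0)

summand-zero : ∀ {n} {f : Fin n → ℚ} → (∀ i → 0ℚ ≤ℚ f i) → sumℚ f ≡ 0ℚ → ∀ i → f i ≡ 0ℚ
summand-zero {ℕ.suc n} {f} 0≤f Σf≡0 = λ where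
    zero    → f₀≡0
    (suc i) → summand-zero (0≤f ∘ suc) Σtail≡0 i
  where
  f₀≤Σf : f zero ≤ℚ sumℚ f
  f₀≤Σf = subst (_≤ℚ sumℚ f) (ℚ.+-identityʳ _) (ℚ.+-monoʳ-≤ (f zero) (sumℚ-nonNeg (0≤f ∘ suc)))
  f₀≡0 : f zero ≡ 0ℚ
  f₀≡0 = ℚ.≤-antisym (subst (f zero ≤ℚ_) Σf≡0 f₀≤Σf) (0≤f zero)
  Σtail≡0 : sumℚ (f ∘ suc) ≡ 0ℚ
  Σtail≡0 = begin
    sumℚ (f ∘ suc)          ≡⟨ ℚ.+-identityˡ _ ⟨
    0ℚ + sumℚ (f ∘ suc)     ≡⟨ cong (_+ sumℚ (f ∘ suc)) f₀≡0 ⟨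
    f zero + sumℚ (f ∘ suc) ≡⟨ Σf≡0 ⟩
    0ℚ                      ∎

sumℚ-single : ∀ {n} {f : Fin n → ℚ} i → (∀ j → j ≢ i → f j ≡ 0ℚ) → sumℚ f ≡ f i
sumℚ-single {ℕ.suc n} {f} zero f≡0 =
  trans (cong (f zero +_) (trans (sumℚ-cong (λ j → f≡0 (suc j) λ ())) (sumℚ-zero n)))
        (ℚ.+-identityʳ _)
sumℚ-single {ℕ.suc n} {f} (suc i) f≡0 =
  trans (cong₂ _+_ (f≡0 zero λ ()) (sumℚ-single i (λ j j≢i → f≡0 (suc j) λ { refl → j≢i refl })))
        (ℚ.+-identityˡ _)

sumℚ-↑ : ∀ m {n} (f : Fin (m ℕ.+ n) → ℚ) →
  sumℚ f ≡ sumℚ (λ i → f (i ↑ˡ n)) + sumℚ (λ j → f (m ↑ʳ j))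
sumℚ-↑ ℕ.zero    f = sym (ℚ.+-identityˡ _)
sumℚ-↑ (ℕ.suc m) f = trans (cong (f zero +_) (sumℚ-↑ m (f ∘ suc))) (sym (ℚ.+-assoc (f zero) _ _))

sumℚ-combine : ∀ m {n} (f : Fin (m ℕ.* n) → ℚ) →
  sumℚ f ≡ sumℚ (λ (i : Fin m) → sumℚ (λ (j : Fin n) → f (combine i j)))
sumℚ-combine ℕ.zero        f = refl
sumℚ-combine (ℕ.suc m) {n} f = trans (sumℚ-↑ n f)
  (cong (sumℚ (λ j → f (j ↑ˡ (m ℕ.* n))) +_) (sumℚ-combine m (λ v → f (n ↑ʳ v))))

-- Kronecker deltas as unit vectors

δ-diag : ∀ {n} (i : Fin n) → δ i i ≡ 1ℚ
δ-diag i with i ≟ i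
... | yes _   = refl
... | no  i≢i = contradiction refl i≢i

δ-off : ∀ {n} {i j : Fin n} → i ≢ j → δ i j ≡ 0ℚ
δ-off {i = i} {j} i≢j with i ≟ j
... | yes i≡j = contradiction i≡j i≢j
... | no  _   = refl

δ-nonNeg : ∀ {n} (i j : Fin n) → 0ℚ ≤ℚ δ i j
δ-nonNeg i j with i ≟ j
... | yes _ = 0≤1
... | no  _ = ℚ.≤-refl

sumℚ-δ : ∀ {n} (i : Fin n) → sumℚ (δ i) ≡ 1ℚ
sumℚ-δ i = trans (sumℚ-single i (λ j j≢i → δ-off (j≢i ∘ sym))) (δ-diag i)

sumℚ-*δ : ∀ {n} (f : Fin n → ℚ) t → sumℚ (λ i → f i * δ i t) ≡ f t
sumℚ-*δ f t = trans (sumℚ-single t (λ i i≢t → trans (cong (f i *_) (δ-off i≢t)) (ℚ.*-zeroʳ (f i))))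
  (trans (cong (f t *_) (δ-diag t)) (ℚ.*-identityʳ (f t)))

sumℚ-δ* : ∀ {n} (f : Fin n → ℚ) t → sumℚ (λ i → δ t i * f i) ≡ f t
sumℚ-δ* f t = trans (sumℚ-single t (λ i i≢t → trans (cong (_* f i) (δ-off (i≢t ∘ sym))) (ℚ.*-zeroˡ (f i))))
  (trans (cong (_* f t) (δ-diag t)) (ℚ.*-identityˡ (f t)))

-- Sums over the twelve vertices as triple sums

decode-combine : ∀ i j k → decode (combine i (combine j k)) ≡ (i , j , k)
decode-combine i j k = trans
  (cong (λ (i , r) → i , remQuot 3 r) (remQuot-combine i (combine j k)))
  (cong (i ,_) (remQuot-combine j k))

sumℚ-decode : (g : Fin 2 × Fin 2 × Fin 3 → ℚ) →
  sumℚ (g ∘ decode) ≡ sumℚ λ i → sumℚ λ j → sumℚ λ k → g (i , j , k)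
sumℚ-decode g = trans (sumℚ-combine 2 {6} (g ∘ decode))
  (sumℚ-cong λ i → trans (sumℚ-combine 2 {3} (λ r → g (decode (combine i r))))
    (sumℚ-cong λ j → sumℚ-cong λ k → cong g (decode-combine i j k)))

sumℚ-product : ∀ {l m n} (p : Fin l → ℚ) (q : Fin m → ℚ) (r : Fin n → ℚ) →
  sumℚ (λ i → sumℚ λ j → sumℚ λ k → p i * q j * r k) ≡ sumℚ p * sumℚ q * sumℚ r
sumℚ-product p q r = begin
  sumℚ (λ i → sumℚ λ j → sumℚ λ k → p i * q j * r k) ≡⟨ sumℚ-cong (λ i → sumℚ-cong λ j → sumℚ-*ˡ (p i * q j) r) ⟩
  sumℚ (λ i → sumℚ λ j → p i * q j * sumℚ r)         ≡⟨ sumℚ-cong (λ i → trans (sumℚ-*ʳ (sumℚ r) (λ j → p i * q j)) (cong (_* sumℚ r) (sumℚ-*ˡ (p i) q))) ⟩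
  sumℚ (λ i → p i * sumℚ q * sumℚ r)                 ≡⟨ trans (sumℚ-*ʳ (sumℚ r) (λ i → p i * sumℚ q)) (cong (_* sumℚ r) (sumℚ-*ʳ (sumℚ q) p)) ⟩
  sumℚ p * sumℚ q * sumℚ r                           ∎

-- Convex combinations and linear forms

-- The product distribution with marginals `a`, `b` and `c`. It writes every point of P as a
-- combination of vertices, so linear identities checked at the vertices hold on all of P.
productWeights : Point → Fin 12 → ℚ
productWeights (a , b , c) v = let i , j , k = decode v in a i * b j * c k

productWeights-combination : ∀ x → InP x → IsCombination (productWeights x) x
productWeights-combination (a , b , c) ((_ , Σa≡1) , (_ , Σb≡1) , (_ , Σc≡1)) =
    (λ t → trans (sumℚ-decode (λ (i , j , k) → a i * b j * c k * δ i t)) (trans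
      -- The delta moves next to the factor it selects; the triple sum then splits into three sums,
      -- two of which equal 1.
      (sumℚ-cong λ i → sumℚ-cong λ j → sumℚ-cong λ k →
        solve 4 (λ x y z d → x :* y :* z :* d := x :* d :* y :* z) refl (a i) (b j) (c k) (δ i t))
      (factors (λ i → a i * δ i t) b c (sumℚ-*δ a t) Σb≡1 Σc≡1 (trans (ℚ.*-identityʳ _) (ℚ.*-identityʳ _)))))
  , (λ t → trans (sumℚ-decode (λ (i , j , k) → a i * b j * c k * δ j t)) (trans
      (sumℚ-cong λ i → sumℚ-cong λ j → sumℚ-cong λ k →
        solve 4 (λ x y z d → x :* y :* z :* d := x :* (y :* d) :* z) refl (a i) (b j) (c k) (δ j t))
      (factors a (λ j → b j * δ j t) c Σa≡1 (sumℚ-*δ b t) Σc≡1 (trans (ℚ.*-identityʳ _) (ℚ.*-identityˡ _)))))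
  , (λ t → trans (sumℚ-decode (λ (i , j , k) → a i * b j * c k * δ k t)) (trans
      (sumℚ-cong λ i → sumℚ-cong λ j → sumℚ-cong λ k → ℚ.*-assoc (a i * b j) (c k) (δ k t))
      (factors a b (λ k → c k * δ k t) Σa≡1 Σb≡1 (sumℚ-*δ c t) (ℚ.*-identityˡ _))))
  where
  open +-*-Solver
  factors : ∀ {l m n} (p : Fin l → ℚ) (q : Fin m → ℚ) (r : Fin n → ℚ) {x y z w} →
    sumℚ p ≡ x → sumℚ q ≡ y → sumℚ r ≡ z → x * y * z ≡ w →
    sumℚ (λ i → sumℚ λ j → sumℚ λ k → p i * q j * r k) ≡ w
  factors p q r refl refl refl e = trans (sumℚ-product p q r) e

vertex-inP : ∀ v → InP (vertex v)
vertex-inP v = let i , j , k = decode v in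
  (δ-nonNeg i , sumℚ-δ i) , (δ-nonNeg j , sumℚ-δ j) , (δ-nonNeg k , sumℚ-δ k)

-- Interchange the two sums: each `e v` has total 1, so a block of coordinates records the total
-- weight.
sum-weights : ∀ {m n} (λs : Fin m → ℚ) (e : Fin m → Fin n → ℚ) {a : Fin n → ℚ} →
  (∀ v → sumℚ (e v) ≡ 1ℚ) → (∀ t → sumℚ (λ v → λs v * e v t) ≡ a t) → sumℚ a ≡ sumℚ λs
sum-weights λs e {a} Σe≡1 comb = begin
  sumℚ a                                ≡⟨ sumℚ-cong comb ⟨
  sumℚ (λ t → sumℚ λ v → λs v * e v t)  ≡⟨ sumℚ-comm (λ t v → λs v * e v t) ⟩
  sumℚ (λ v → sumℚ λ t → λs v * e v t)  ≡⟨ sumℚ-cong (λ v → trans (sumℚ-*ˡ (λs v) (e v))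
                                            (trans (cong (λs v *_) (Σe≡1 v)) (ℚ.*-identityʳ (λs v)))) ⟩
  sumℚ λs                               ∎

inStdSimplex-convex : ∀ {m n} (λs : Fin m → ℚ) (e : Fin m → Fin n → ℚ) {a : Fin n → ℚ} →
  (∀ v → InStdSimplex (e v)) → (∀ v → 0ℚ ≤ℚ λs v) → sumℚ λs ≡ 1ℚ →
  (∀ t → sumℚ (λ v → λs v * e v t) ≡ a t) → InStdSimplex a
inStdSimplex-convex λs e e∈Δ 0≤λ Σλ≡1 comb =
    (λ t → subst (0ℚ ≤ℚ_) (comb t) (sumℚ-nonNeg λ v → *-nonNeg (0≤λ v) (proj₁ (e∈Δ v) t)))
  , trans (sum-weights λs e (proj₂ ∘ e∈Δ) comb) Σλ≡1

inConv⇒inP : ∀ {S x} → InConv S x → InP x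
inConv⇒inP (λs , 0≤λ , _ , Σλ≡1 , ca , cb , cc) =
    inStdSimplex-convex λs (proj₁ ∘ vertex) (proj₁ ∘ vertex-inP) 0≤λ Σλ≡1 ca
  , inStdSimplex-convex λs (proj₁ ∘ proj₂ ∘ vertex) (proj₁ ∘ proj₂ ∘ vertex-inP) 0≤λ Σλ≡1 cb
  , inStdSimplex-convex λs (proj₂ ∘ proj₂ ∘ vertex) (proj₂ ∘ proj₂ ∘ vertex-inP) 0≤λ Σλ≡1 cc

combination-sum : ∀ λs {x} → InP x → IsCombination λs x → sumℚ λs ≡ 1ℚ
combination-sum λs ((_ , Σa≡1) , _) (ca , _) =
  trans (sym (sum-weights λs (proj₁ ∘ vertex) (proj₂ ∘ proj₁ ∘ vertex-inP) ca)) Σa≡1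

-- A form is homogeneous in the seven coordinates of P; constants come for free,
-- since each of the three blocks of coordinates sums to 1.
Form : Set
Form = Fin 7 → ℚ

coord : Point → Fin 7 → ℚ
coord x 0F = proj₁ x 0F
coord x 1F = proj₁ x 1F
coord x 2F = proj₁ (proj₂ x) 0F
coord x 3F = proj₁ (proj₂ x) 1F
coord x 4F = proj₂ (proj₂ x) 0F
coord x 5F = proj₂ (proj₂ x) 1F
coord x 6F = proj₂ (proj₂ x) 2F

coord-combination : ∀ λs {x} → IsCombination λs x → ∀ t → sumℚ (λ v → λs v * coord (vertex v) t) ≡ coord x t
coord-combination _ (ca , cb , cc) 0F = ca 0F
coord-combination _ (ca , cb , cc) 1F = ca 1F
coord-combination _ (ca , cb , cc) 2F = cb 0F
coord-combination _ (ca , cb , cc) 3F = cb 1F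
coord-combination _ (ca , cb , cc) 4F = cc 0F
coord-combination _ (ca , cb , cc) 5F = cc 1F
coord-combination _ (ca , cb , cc) 6F = cc 2F

combination-coord : ∀ λs {x} → (∀ t → sumℚ (λ v → λs v * coord (vertex v) t) ≡ coord x t) → IsCombination λs x
combination-coord _ c =
    (λ { 0F → c 0F ; 1F → c 1F })
  , (λ { 0F → c 2F ; 1F → c 3F })
  , (λ { 0F → c 4F ; 1F → c 5F ; 2F → c 6F })

⟨_,_⟩ : Form → Point → ℚ
⟨ f , x ⟩ = sumℚ λ t → f t * coord x t

⟨,⟩-combination : ∀ f λs {x} → IsCombination λs x → ⟨ f , x ⟩ ≡ sumℚ λ v → λs v * ⟨ f , vertex v ⟩
⟨,⟩-combination f λs {x} comb = begin
  sumℚ (λ t → f t * coord x t)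
    ≡⟨ sumℚ-cong (λ t → trans (cong (f t *_) (sym (coord-combination λs comb t))) (sym (sumℚ-*ˡ (f t) (λ v → λs v * coord (vertex v) t)))) ⟩
  sumℚ (λ t → sumℚ λ v → f t * (λs v * coord (vertex v) t))
    ≡⟨ sumℚ-comm (λ t v → f t * (λs v * coord (vertex v) t)) ⟩
  sumℚ (λ v → sumℚ λ t → f t * (λs v * coord (vertex v) t))
    ≡⟨ sumℚ-cong (λ v → trans (sumℚ-cong (λ t → solve 3 (λ x y z → x :* (y :* z) := y :* (x :* z)) refl (f t) (λs v) (coord (vertex v) t)))
                              (sumℚ-*ˡ (λs v) (λ t → f t * coord (vertex v) t))) ⟩
  sumℚ (λ v → λs v * ⟨ f , vertex v ⟩) ∎
  where open +-*-Solver

-- The value at `x` is a nonnegatively weighted sum of values at vertices in `S`, so it cannot be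
-- positive if none of those is. Searching the vertices turns this contrapositive into a witness.
positive-vertex : ∀ f {S x} → InConv S x → 0ℚ < ⟨ f , x ⟩ → ∃ λ v → v ∈ S × 0ℚ < ⟨ f , vertex v ⟩
positive-vertex f {S} {x} (λs , 0≤λ , supp , _ , comb) 0<fx
  with any? (λ v → v ∈? S ×-dec 0ℚ <? ⟨ f , vertex v ⟩)
... | yes found = found
... | no  none  = ⊥-elim (ℚ.<-irrefl refl (ℚ.<-≤-trans 0<fx (subst (_≤ℚ 0ℚ) (sym (⟨,⟩-combination f λs comb)) (sumℚ-nonPos term≤0))))
  where
  term≤0 : ∀ v → λs v * ⟨ f , vertex v ⟩ ≤ℚ 0ℚ
  term≤0 v with v ∈? S
  ... | yes v∈S = subst (λs v * _ ≤ℚ_) (ℚ.*-zeroʳ (λs v))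
        (ℚ.*-monoˡ-≤-nonNeg (λs v) {{nonNegative (0≤λ v)}} (ℚ.≮⇒≥ λ 0<fv → none (v , v∈S , 0<fv)))
  ... | no  v∉S rewrite supp v v∉S = ℚ.≤-reflexive (ℚ.*-zeroˡ ⟨ f , vertex v ⟩)

-- Ten points, no two in a common simplex

α β : Fin 2 → Form
α i = δ (i ↑ˡ 5)
β j = δ (2 ↑ʳ (j ↑ˡ 3))

γ : Fin 3 → Form
γ k = δ (4 ↑ʳ k)

infixl 6 _⊕_ _⊖_
_⊕_ _⊖_ : Form → Form → Form
(f ⊕ g) t = f t + g t
(f ⊖ g) t = f t - g t

_∕_ : ℕ → (n : ℕ) .{{_ : ℕ.NonZero n}} → ℚ
m ∕ n = ℤ.+ m / n

near : ∀ {n} → Fin n → ℚ → ℚ → Fin n → ℚ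
near i p q t = if does (i ≟ t) then p else q

-- Near the midpoint of the edge from (i , 0 , k) to (i , 1 , k), but off every
-- hyperplane spanned by vertices.
edgePoint : Fin 2 × Fin 3 → Point
edgePoint (i , k) = near i (6 ∕ 7) (1 ∕ 7) , near 0F (4 ∕ 7) (3 ∕ 7) , near k (7 ∕ 9) (1 ∕ 9)

-- The constants satisfy 1/7 < 2/7 < 1/3 < 1/7 + 2/7 and 5/7 < 6/7, which is what makes all of
-- `centreForms` positive here.
centrePoint : Fin 2 × Fin 2 → Point
centrePoint (i , j) = near i (5 ∕ 7) (2 ∕ 7) , near j (6 ∕ 7) (1 ∕ 7) , λ _ → 1 ∕ 3

-- Among the vertices, the first two forms are positive only at (i, 1, k) and (i, 0, k), which
-- forces both ends of the edge into the simplex. The third asks for a vertex over `i` away from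
-- `k`; the last two ask for vertices over `i′` avoiding each of the two indices other than `k`.
edgeForms : Fin 2 × Fin 3 → List Form
edgeForms (i , k) =
  γ k ⊖ α i′ ⊖ β 0F ∷ γ k ⊖ α i′ ⊖ β 1F ∷ α i ⊖ γ k ∷
  α i′ ⊖ γ (punchIn k 0F) ∷ α i′ ⊖ γ (punchIn k 1F) ∷ []
  where i′ = opposite i

-- The first six forms ask, for each triangle index, for a vertex with second index `j` and one with
-- first index `i`; the seventh asks for a vertex over (i′, j). Each of the last three asks for a
-- vertex not over (i, j) that avoids a given triangle index or lies over (i′, j′).
centreForms : Fin 2 × Fin 2 → List Form
centreForms (i , j) =
  γ 0F ⊖ β j′ ∷ γ 1F ⊖ β j′ ∷ γ 2F ⊖ β j′ ∷
  γ 0F ⊖ α i′ ∷ γ 1F ⊖ α i′ ∷ γ 2F ⊖ α i′ ∷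
  β j ⊖ α i ∷
  α i′ ⊕ β j′ ⊖ γ 0F ∷ α i′ ⊕ β j′ ⊖ γ 1F ∷ α i′ ⊕ β j′ ⊖ γ 2F ∷ []
  where
  i′ = opposite i
  j′ = opposite j

-- Reduction of the separation claim to a finite search

positiveVertices : Form → Subset 12
positiveVertices f = tabulate λ v → does (0ℚ <? ⟨ f , vertex v ⟩)

MeetsAll : Subset 12 → List (Subset 12) → Set
MeetsAll S = All λ F → Nonempty (F ∩ S)

meetsAll? : ∀ S Fs → Dec (MeetsAll S Fs)
meetsAll? S = All.all? λ F → nonempty? (F ∩ S)

inConv⇒meetsAll : ∀ {S x} fs → InConv S x → All (λ f → 0ℚ < ⟨ f , x ⟩) fs →
  MeetsAll S (List.map positiveVertices fs)
inConv⇒meetsAll {S} {x} fs conv 0<fs = All.map⁺ (All.map {P = λ f → 0ℚ < ⟨ f , x ⟩} (λ {f} → meets f) {fs} 0<fs)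
  where
  meets : ∀ f → 0ℚ < ⟨ f , x ⟩ → Nonempty (positiveVertices f ∩ S)
  meets f 0<fx with positive-vertex f conv 0<fx
  ... | v , v∈S , 0<fv = v , x∈p∩q⁺ (lookup⇒[]= v (positiveVertices f)
          (trans (lookup∘tabulate (λ v → does (0ℚ <? ⟨ f , vertex v ⟩)) v) (dec-true (0ℚ <? ⟨ f , vertex v ⟩) 0<fv)) , v∈S)

-- The condition on `m` precedes the quantifier over `n`, so the search tries a second point only
-- for subsets that pass the first.
MeetsTwo : Vec (List (Subset 12)) 10 → Subset 12 → Set
MeetsTwo Fs S = ∣ S ∣ ≡ 5 ×
  ∃ λ m → MeetsAll S (lookup Fs m) × ∃ λ n → m <ᶠ n × MeetsAll S (lookup Fs n)

-- The families are a parameter so that each is evaluated once and shared between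
-- all subsets.
meetsTwo? : ∀ Fs → Dec (∃ (MeetsTwo Fs))
meetsTwo? Fs = anySubset? λ S → (∣ S ∣ ℕ.≟ 5) ×-dec
  any? λ m → meetsAll? S (lookup Fs m) ×-dec any? λ n → (m <ᶠ? n) ×-dec meetsAll? S (lookup Fs n)

inP? : ∀ x → Dec (InP x)
inP? (a , b , c) = inStdSimplex? a ×-dec inStdSimplex? b ×-dec inStdSimplex? c
  where
  inStdSimplex? : ∀ {n} (a : Fin n → ℚ) → Dec (InStdSimplex a)
  inStdSimplex? a = all? (λ i → 0ℚ ≤? a i) ×-dec (sumℚ a ℚ.≟ 1ℚ)

abstract
  fromSix+Four : ∀ {X : Set} → (Fin 2 × Fin 3 → X) → (Fin 2 × Fin 2 → X) → Fin 10 → X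
  fromSix+Four f g n = [ f ∘ remQuot 3 , g ∘ remQuot 2 ]′ (splitAt 6 n)

  point : Fin 10 → Point
  point = fromSix+Four edgePoint centrePoint

  forms : Fin 10 → List Form
  forms = fromSix+Four edgeForms centreForms

  families : Vec (List (Subset 12)) 10
  families = tabulate λ n → List.map positiveVertices (forms n)

  point-inP : ∀ n → InP (point n)
  point-inP = from-yes (all? λ n → inP? (point n))

  forms-positive : ∀ n → All (λ f → 0ℚ < ⟨ f , point n ⟩) (forms n)
  forms-positive = from-yes (all? λ n → All.all? (λ f → 0ℚ <? ⟨ f , point n ⟩) (forms n))

  -- Decided by search over the 4096 subsets. For two edge points over the same `i`, the edges use
  -- four vertices and the fifth would need two different triangle indices; over different `i`, each
  -- edge needs a further vertex of its own, six in all.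
  ¬meetsTwo : ¬ ∃ (MeetsTwo families)
  ¬meetsTwo = from-no (meetsTwo? families)

  point⇒meetsAll : ∀ {S} n → InConv S (point n) → MeetsAll S (lookup families n)
  point⇒meetsAll {S} n conv = subst (MeetsAll S)
    (sym (lookup∘tabulate (λ n → List.map positiveVertices (forms n)) n))
    (inConv⇒meetsAll (forms n) conv (forms-positive n))

points-separated : ∀ (σ : Simplex4) {m n} → m <ᶠ n →
  InConv (verts σ) (point m) → InConv (verts σ) (point n) → ⊥
points-separated σ {m} {n} m<n cm cn =
  ¬meetsTwo (verts σ , card5 σ , m , point⇒meetsAll m cm , n , m<n , point⇒meetsAll n cn)

cover-size : ∀ C → IsCover C → 10 ≤ length C
-- The pigeonholes are positions in the list, which can be compared without deciding equality of
-- simplices.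
cover-size C (covers , _) = ℕ.≮⇒≥ λ short → impossible (pigeonhole short (λ n → index (member n)))
  where
  holder : Fin 10 → Simplex4
  holder n = proj₁ (covers (point n) (point-inP n))
  member : ∀ n → holder n ∈ₗ C
  member n = proj₁ (proj₂ (covers (point n) (point-inP n)))
  holds : ∀ n → InConv (verts (holder n)) (point n)
  holds n = proj₂ (proj₂ (covers (point n) (point-inP n)))
  impossible : ¬ ∃ λ m → ∃ λ n → m <ᶠ n × index (member m) ≡ index (member n)
  impossible (m , n , m<n , same) = points-separated (holder m) m<n (holds m)
    (subst (λ σ → InConv (verts σ) (point n)) holder-same (holds n))
    where
    holder-same : holder n ≡ holder m
    holder-same = trans (lookup-index (member n))
      (trans (cong (List.lookup C) (sym same)) (sym (lookup-index (member m))))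

-- The triangulation

-- The wall of a simplex opposite a given vertex lies on the facet of P where
-- coordinate t vanishes (on t) or is shared with simplex r (by r); the entry is ·
-- if the vertex does not belong to the simplex.
data Wall : Set where
  ·  : Wall
  on : Fin 7 → Wall
  by : Fin 10 → Wall

isVertex : Wall → Bool
isVertex · = outside
isVertex _ = inside

abstract
  -- Heights ≥ 4 leave room for natural coefficients in all the forms below.
  height : Fin 12 → ℚ
  height v = lookup (6 ∷ 4 ∷ 6 ∷ 6 ∷ 5 ∷ 4 ∷ 6 ∷ 5 ∷ 4 ∷ 4 ∷ 4 ∷ 5 ∷ []) v ∕ 1

  -- Row `s` is the linear form whose graph carries the lower-hull face over simplex `s`.
  piece : Fin 10 → Form
  piece s t = lookup (lookup table s) t ∕ 1
    where
    table : Vec (Vec ℕ 7) 10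
    table =
      (2 ∷ 0 ∷ 2 ∷ 0 ∷ 2 ∷ 0 ∷ 2 ∷ []) ∷
      (2 ∷ 0 ∷ 0 ∷ 0 ∷ 4 ∷ 2 ∷ 2 ∷ []) ∷
      (1 ∷ 0 ∷ 1 ∷ 0 ∷ 4 ∷ 2 ∷ 3 ∷ []) ∷
      (0 ∷ 0 ∷ 2 ∷ 0 ∷ 4 ∷ 2 ∷ 2 ∷ []) ∷
      (2 ∷ 0 ∷ 0 ∷ 1 ∷ 3 ∷ 2 ∷ 1 ∷ []) ∷
      (1 ∷ 0 ∷ 0 ∷ 1 ∷ 3 ∷ 3 ∷ 2 ∷ []) ∷
      (0 ∷ 0 ∷ 0 ∷ 0 ∷ 4 ∷ 4 ∷ 4 ∷ []) ∷
      (0 ∷ 1 ∷ 2 ∷ 0 ∷ 3 ∷ 2 ∷ 1 ∷ []) ∷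
      (0 ∷ 1 ∷ 1 ∷ 0 ∷ 3 ∷ 3 ∷ 2 ∷ []) ∷
      (0 ∷ 1 ∷ 0 ∷ 1 ∷ 2 ∷ 2 ∷ 3 ∷ []) ∷ []

  walls : Fin 10 → Vec Wall 12
  walls = lookup (
    (on 4F ∷ on 5F ∷ by 2F ∷ ·     ∷ ·     ∷ on 3F ∷ ·     ∷ ·     ∷ on 1F ∷ ·     ∷ ·     ∷ ·     ∷ []) ∷
    (by 4F ∷ on 5F ∷ ·     ∷ by 2F ∷ ·     ∷ on 6F ∷ ·     ∷ ·     ∷ ·     ∷ on 1F ∷ ·     ∷ ·     ∷ []) ∷
    (by 6F ∷ on 5F ∷ ·     ∷ ·     ∷ ·     ∷ by 3F ∷ ·     ∷ ·     ∷ by 1F ∷ by 0F ∷ ·     ∷ ·     ∷ []) ∷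
    (by 7F ∷ on 5F ∷ ·     ∷ ·     ∷ ·     ∷ ·     ∷ by 2F ∷ ·     ∷ on 6F ∷ on 3F ∷ ·     ∷ ·     ∷ []) ∷
    (·     ∷ on 2F ∷ ·     ∷ by 5F ∷ by 1F ∷ on 6F ∷ ·     ∷ ·     ∷ ·     ∷ on 1F ∷ ·     ∷ ·     ∷ []) ∷
    (·     ∷ on 2F ∷ ·     ∷ ·     ∷ by 6F ∷ on 6F ∷ ·     ∷ ·     ∷ ·     ∷ on 4F ∷ by 4F ∷ ·     ∷ []) ∷
    (·     ∷ by 9F ∷ ·     ∷ ·     ∷ ·     ∷ by 8F ∷ ·     ∷ ·     ∷ by 5F ∷ on 4F ∷ by 2F ∷ ·     ∷ []) ∷
    (·     ∷ on 0F ∷ ·     ∷ ·     ∷ ·     ∷ ·     ∷ by 8F ∷ by 3F ∷ on 6F ∷ on 3F ∷ ·     ∷ ·     ∷ []) ∷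
    (·     ∷ on 0F ∷ ·     ∷ ·     ∷ ·     ∷ ·     ∷ ·     ∷ by 6F ∷ on 6F ∷ on 4F ∷ by 7F ∷ ·     ∷ []) ∷
    (·     ∷ ·     ∷ ·     ∷ ·     ∷ ·     ∷ on 0F ∷ ·     ∷ ·     ∷ on 2F ∷ on 4F ∷ on 5F ∷ by 6F ∷ []) ∷ [])

  -- Volume is normalised so that the ten simplices have total volume 12.
  reciprocalVolume : Fin 10 → ℚ
  reciprocalVolume 2F = ½
  reciprocalVolume 6F = ½
  reciprocalVolume _  = 1ℚ

corners : Fin 10 → Subset 12
corners s = Vec.map isVertex (walls s)

wallForm : Fin 10 → Wall → Form
wallForm s ·      t = 0ℚ
wallForm s (on i) t = δ i t
wallForm s (by r) t = reciprocalVolume s * (piece s t - piece r t)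

-- The barycentric coordinate of corner `u` in simplex `s`: it vanishes on the opposite wall and is
-- scaled to 1 at `u`.
bary : Fin 10 → Fin 12 → Form
bary s u = wallForm s (lookup (walls s) u)

abstract
  reciprocalVolume-nonNeg : ∀ s → 0ℚ ≤ℚ reciprocalVolume s
  reciprocalVolume-nonNeg = from-yes (all? λ s → 0ℚ ≤? reciprocalVolume s)

  -- Certifies the hull by evaluation. The strict inequality off the corners is what later forces
  -- weights to vanish.
  lower-hull : ∀ s v → (v ∈ corners s × ⟨ piece s , vertex v ⟩ ≡ height v)
                     ⊎ (v ∉ corners s × ⟨ piece s , vertex v ⟩ < height v)
  lower-hull = from-yes (all? λ s → all? λ v →
    (v ∈? corners s ×-dec ⟨ piece s , vertex v ⟩ ℚ.≟ height v) ⊎-dec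
    (¬? (v ∈? corners s) ×-dec ⟨ piece s , vertex v ⟩ <? height v))

  bary-dual : ∀ s u → u ∈ corners s → ∀ v → v ∈ corners s → ⟨ bary s u , vertex v ⟩ ≡ δ u v
  bary-dual = from-yes (all? λ s → all? λ u → u ∈? corners s →-dec all? λ v → v ∈? corners s →-dec
    ⟨ bary s u , vertex v ⟩ ℚ.≟ δ u v)

  -- Ranges over all twelve vertices, including those outside simplex `s`, where coordinates may be
  -- negative; this is what allows extension to all of P.
  bary-vertex : ∀ s v t → sumℚ (λ u → ⟨ bary s u , vertex v ⟩ * coord (vertex u) t) ≡ coord (vertex v) t
  bary-vertex = from-yes (all? λ s → all? λ v → all? λ t →
    sumℚ (λ u → ⟨ bary s u , vertex v ⟩ * coord (vertex u) t) ℚ.≟ coord (vertex v) t)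

  corners-card : ∀ s → ∣ corners s ∣ ≡ 5
  corners-card = from-yes (all? λ s → ∣ corners s ∣ ℕ.≟ 5)

  corners-injective : ∀ s r → corners s ≡ corners r → s ≡ r
  corners-injective = from-yes (all? λ s → all? λ r → ≡-dec Bool._≟_ (corners s) (corners r) →-dec (s ≟ r))

-- Barycentric coordinates and the covering property

sumℚ-difference : ∀ {n} (f g : Fin n → ℚ) → sumℚ (λ i → f i - g i) ≡ sumℚ f - sumℚ g
sumℚ-difference {ℕ.zero}  f g = refl
sumℚ-difference {ℕ.suc n} f g = trans (cong (λ S → f zero - g zero + S) (sumℚ-difference (f ∘ suc) (g ∘ suc)))
  (solve 4 (λ a b c d → a :- b :+ (c :- d) := a :+ c :- (b :+ d)) refl (f zero) (g zero) (sumℚ (f ∘ suc)) (sumℚ (g ∘ suc)))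
  where open +-*-Solver

⟨,⟩-scaled-difference : ∀ c f g x → ⟨ (λ t → c * (f t - g t)) , x ⟩ ≡ c * (⟨ f , x ⟩ - ⟨ g , x ⟩)
⟨,⟩-scaled-difference c f g x = begin
  sumℚ (λ t → c * (f t - g t) * coord x t)
    ≡⟨ sumℚ-cong (λ t → solve 4 (λ c f g y → c :* (f :- g) :* y := c :* (f :* y :- g :* y)) refl c (f t) (g t) (coord x t)) ⟩
  sumℚ (λ t → c * (f t * coord x t - g t * coord x t))
    ≡⟨ sumℚ-*ˡ c (λ t → f t * coord x t - g t * coord x t) ⟩
  c * sumℚ (λ t → f t * coord x t - g t * coord x t)
    ≡⟨ cong (c *_) (sumℚ-difference (λ t → f t * coord x t) (λ t → g t * coord x t)) ⟩
  c * (⟨ f , x ⟩ - ⟨ g , x ⟩) ∎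
  where open +-*-Solver

≤⇒0≤- : ∀ {p q} → p ≤ℚ q → 0ℚ ≤ℚ q - p
≤⇒0≤- {p} {q} p≤q = subst (_≤ℚ q - p) (ℚ.+-inverseʳ p) (ℚ.+-monoˡ-≤ (- p) p≤q)

<⇒0<- : ∀ {p q} → p < q → 0ℚ < q - p
<⇒0<- {p} {q} p<q = subst (_< q - p) (ℚ.+-inverseʳ p) (ℚ.+-monoˡ-< (- p) p<q)

⟨0,_⟩ : ∀ x → ⟨ (λ _ → 0ℚ) , x ⟩ ≡ 0ℚ
⟨0, x ⟩ = trans (sumℚ-cong (λ t → ℚ.*-zeroˡ (coord x t))) (sumℚ-zero 7)

coord-nonNeg : ∀ {x} → InP x → ∀ t → 0ℚ ≤ℚ coord x t
coord-nonNeg ((0≤a , _) , _ , _) 0F = 0≤a 0F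
coord-nonNeg ((0≤a , _) , _ , _) 1F = 0≤a 1F
coord-nonNeg (_ , (0≤b , _) , _) 2F = 0≤b 0F
coord-nonNeg (_ , (0≤b , _) , _) 3F = 0≤b 1F
coord-nonNeg (_ , _ , (0≤c , _)) 4F = 0≤c 0F
coord-nonNeg (_ , _ , (0≤c , _)) 5F = 0≤c 1F
coord-nonNeg (_ , _ , (0≤c , _)) 6F = 0≤c 2F

wallForm-nonNeg : ∀ {x} s → InP x → (∀ r → ⟨ piece r , x ⟩ ≤ℚ ⟨ piece s , x ⟩) →
  ∀ w → 0ℚ ≤ℚ ⟨ wallForm s w , x ⟩
wallForm-nonNeg {x} s x∈P max ·      = ℚ.≤-reflexive (sym ⟨0, x ⟩)
wallForm-nonNeg {x} s x∈P max (on t) = subst (0ℚ ≤ℚ_) (sym (sumℚ-δ* (coord x) t)) (coord-nonNeg x∈P t)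
wallForm-nonNeg {x} s x∈P max (by r) =
  subst (0ℚ ≤ℚ_) (sym (⟨,⟩-scaled-difference (reciprocalVolume s) (piece s) (piece r) x))
    (*-nonNeg (reciprocalVolume-nonNeg s) (≤⇒0≤- (max r)))

bary-off : ∀ s u → u ∉ corners s → ∀ x → ⟨ bary s u , x ⟩ ≡ 0ℚ
bary-off s u u∉s x = off (lookup (walls s) u) refl
  where
  inside⇒∈ : ∀ {w} → lookup (walls s) u ≡ w → isVertex w ≡ inside → u ∈ corners s
  inside⇒∈ eq ins = lookup⇒[]= u (corners s) (trans (lookup-map u isVertex (walls s)) (trans (cong isVertex eq) ins))
  off : ∀ w → lookup (walls s) u ≡ w → ⟨ wallForm s w , x ⟩ ≡ 0ℚ
  off ·      eq = ⟨0, x ⟩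
  off (on t) eq = contradiction (inside⇒∈ eq refl) u∉s
  off (by r) eq = contradiction (inside⇒∈ eq refl) u∉s

-- Both sides are linear in `x`, so expanding `x` in its product weights reduces the claim to
-- `bary-vertex`.
bary-combination : ∀ s {x} → InP x → IsCombination (λ u → ⟨ bary s u , x ⟩) x
bary-combination s {x} x∈P = combination-coord (λ u → ⟨ bary s u , x ⟩) λ t → begin
  sumℚ (λ u → ⟨ bary s u , x ⟩ * coord (vertex u) t)
    ≡⟨ sumℚ-cong (λ u → trans (cong (_* coord (vertex u) t) (⟨,⟩-combination (bary s u) w w-comb))
                              (sym (sumℚ-*ʳ (coord (vertex u) t) (λ v → w v * ⟨ bary s u , vertex v ⟩)))) ⟩
  sumℚ (λ u → sumℚ λ v → w v * ⟨ bary s u , vertex v ⟩ * coord (vertex u) t)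
    ≡⟨ sumℚ-comm (λ u v → w v * ⟨ bary s u , vertex v ⟩ * coord (vertex u) t) ⟩
  sumℚ (λ v → sumℚ λ u → w v * ⟨ bary s u , vertex v ⟩ * coord (vertex u) t)
    ≡⟨ sumℚ-cong (λ v → trans (sumℚ-cong (λ u → ℚ.*-assoc (w v) ⟨ bary s u , vertex v ⟩ (coord (vertex u) t)))
                              (sumℚ-*ˡ (w v) (λ u → ⟨ bary s u , vertex v ⟩ * coord (vertex u) t))) ⟩
  sumℚ (λ v → w v * sumℚ (λ u → ⟨ bary s u , vertex v ⟩ * coord (vertex u) t))
    ≡⟨ sumℚ-cong (λ v → cong (w v *_) (bary-vertex s v t)) ⟩
  sumℚ (λ v → w v * coord (vertex v) t)
    ≡⟨ coord-combination w w-comb t ⟩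
  coord x t ∎
  where
  w = productWeights x
  w-comb = productWeights-combination x x∈P

-- The barycentric forms are a dual basis: applied to an affine dependence, the form of corner `u`
-- isolates the coefficient `μ u`.
corners-independent : ∀ s → AffinelyIndependent (corners s)
corners-independent s μ supp _ comb u with u ∈? corners s
... | no  u∉s = supp u u∉s
... | yes u∈s = begin
  μ u                                        ≡⟨ ℚ.*-identityʳ (μ u) ⟨
  μ u * 1ℚ                                   ≡⟨ cong (μ u *_) (trans (bary-dual s u u∈s u u∈s) (δ-diag u)) ⟨
  μ u * ⟨ bary s u , vertex u ⟩              ≡⟨ sumℚ-single u others ⟨
  sumℚ (λ v → μ v * ⟨ bary s u , vertex v ⟩) ≡⟨ ⟨,⟩-combination (bary s u) μ comb ⟨
  -- Forms are homogeneous, hence zero at the zero vector.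
  ⟨ bary s u , origin ⟩                      ≡⟨ trans (sumℚ-cong (λ t → trans (cong (bary s u t *_) (origin-coord t)) (ℚ.*-zeroʳ (bary s u t)))) (sumℚ-zero 7) ⟩
  0ℚ                                         ∎
  where
  origin : Point
  origin = (λ _ → 0ℚ) , (λ _ → 0ℚ) , (λ _ → 0ℚ)
  origin-coord : ∀ t → coord origin t ≡ 0ℚ
  origin-coord = λ { 0F → refl ; 1F → refl ; 2F → refl ; 3F → refl ; 4F → refl ; 5F → refl ; 6F → refl }
  others : ∀ v → v ≢ u → μ v * ⟨ bary s u , vertex v ⟩ ≡ 0ℚ
  others v v≢u with v ∈? corners s
  ... | no  v∉s = trans (cong (_* ⟨ bary s u , vertex v ⟩) (supp v v∉s)) (ℚ.*-zeroˡ ⟨ bary s u , vertex v ⟩)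
  ... | yes v∈s = trans (cong (μ v *_) (trans (bary-dual s u u∈s v v∈s) (δ-off (v≢u ∘ sym)))) (ℚ.*-zeroʳ (μ v))

simplex : Fin 10 → Simplex4
simplex s = record { verts = corners s ; card5 = corners-card s ; affInd = corners-independent s }

triangulation : List Simplex4
triangulation = List.tabulate simplex

inSimplex : ∀ {x} s → InP x → (∀ r → ⟨ piece r , x ⟩ ≤ℚ ⟨ piece s , x ⟩) → InConv (corners s) x
inSimplex {x} s x∈P max =
    (λ u → ⟨ bary s u , x ⟩)
  , (λ u → wallForm-nonNeg s x∈P max (lookup (walls s) u))
  , (λ u u∉s → bary-off s u u∉s x)
  , combination-sum (λ u → ⟨ bary s u , x ⟩) x∈P (bary-combination s x∈P)
  , bary-combination s x∈P

maximum-attained : ∀ {n} (f : Fin (ℕ.suc n) → ℚ) → ∃ λ i → ∀ j → f j ≤ℚ f i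
maximum-attained {n} f = argmax f zero (allFin (ℕ.suc n)) ,
  λ j → All.lookup (f[xs]≤f[argmax] {f = f} zero (allFin (ℕ.suc n))) (∈-allFin j)

triangulation-covers : ∀ x → InP x → Σ[ σ ∈ Simplex4 ] (σ ∈ₗ triangulation × InConv (verts σ) x)
triangulation-covers x x∈P = topmost (maximum-attained (λ s → ⟨ piece s , x ⟩))
  where
  topmost : (∃ λ s → ∀ r → ⟨ piece r , x ⟩ ≤ℚ ⟨ piece s , x ⟩) →
    Σ[ σ ∈ Simplex4 ] (σ ∈ₗ triangulation × InConv (verts σ) x)
  topmost (s , max) = simplex s , ∈-tabulate⁺ {f = simplex} s , inSimplex s x∈P max

-- Face-to-face intersection

zero-* : ∀ {p} q → p ≡ 0ℚ → p * q ≡ 0ℚ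
zero-* q refl = ℚ.*-zeroˡ q

*-distribˡ-- : ∀ p q r → p * (q - r) ≡ p * q - p * r
*-distribˡ-- = solve 3 (λ p q r → p :* (q :- r) := p :* q :- p :* r) refl
  where open +-*-Solver

neg-difference : ∀ p q → - (p - q) ≡ q - p
neg-difference = solve 2 (λ p q → :- (p :- q) := q :- p) refl
  where open +-*-Solver

-- On the corners of `s` the height equals `piece s`, so the weighted slack of `piece r` below the
-- heights measures how far `piece r` falls below `piece s` at `x`.
piece-gap : ∀ {x} s r (conv : InConv (corners s) x) →
  sumℚ (λ v → proj₁ conv v * (height v - ⟨ piece r , vertex v ⟩)) ≡ ⟨ piece s , x ⟩ - ⟨ piece r , x ⟩
piece-gap {x} s r (λs , _ , supp , _ , comb) = begin
  sumℚ (λ v → λs v * (height v - ⟨ piece r , vertex v ⟩))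
    ≡⟨ sumℚ-cong on-s ⟩
  sumℚ (λ v → λs v * ⟨ piece s , vertex v ⟩ - λs v * ⟨ piece r , vertex v ⟩)
    ≡⟨ sumℚ-difference (λ v → λs v * ⟨ piece s , vertex v ⟩) (λ v → λs v * ⟨ piece r , vertex v ⟩) ⟩
  sumℚ (λ v → λs v * ⟨ piece s , vertex v ⟩) - sumℚ (λ v → λs v * ⟨ piece r , vertex v ⟩)
    ≡⟨ cong₂ _-_ (⟨,⟩-combination (piece s) λs comb) (⟨,⟩-combination (piece r) λs comb) ⟨
  ⟨ piece s , x ⟩ - ⟨ piece r , x ⟩ ∎
  where
  height-on-s : ∀ v → λs v * height v ≡ λs v * ⟨ piece s , vertex v ⟩
  height-on-s v = cases (lower-hull s v)
    where
    cases : _ → λs v * height v ≡ λs v * ⟨ piece s , vertex v ⟩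
    cases (inj₁ (_ , eq))  = cong (λs v *_) (sym eq)
    cases (inj₂ (v∉s , _)) = trans (zero-* (height v) (supp v v∉s)) (sym (zero-* ⟨ piece s , vertex v ⟩ (supp v v∉s)))
  on-s : ∀ v → λs v * (height v - ⟨ piece r , vertex v ⟩)
             ≡ λs v * ⟨ piece s , vertex v ⟩ - λs v * ⟨ piece r , vertex v ⟩
  on-s v = trans (*-distribˡ-- (λs v) (height v) ⟨ piece r , vertex v ⟩)
                 (cong (_- λs v * ⟨ piece r , vertex v ⟩) (height-on-s v))

height-gap-nonNeg : ∀ r v → 0ℚ ≤ℚ height v - ⟨ piece r , vertex v ⟩
height-gap-nonNeg r v = ≤⇒0≤- ([ ℚ.≤-reflexive ∘ proj₂ , ℚ.<⇒≤ ∘ proj₂ ]′ (lower-hull r v))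

gap-term-nonNeg : ∀ {x} s r (conv : InConv (corners s) x) v →
  0ℚ ≤ℚ proj₁ conv v * (height v - ⟨ piece r , vertex v ⟩)
gap-term-nonNeg s r (_ , 0≤λ , _) v = *-nonNeg (0≤λ v) (height-gap-nonNeg r v)

piece-max : ∀ {x} s r → InConv (corners s) x → 0ℚ ≤ℚ ⟨ piece s , x ⟩ - ⟨ piece r , x ⟩
piece-max s r conv = subst (0ℚ ≤ℚ_) (piece-gap s r conv) (sumℚ-nonNeg (gap-term-nonNeg s r conv))

*-cancel-pos : ∀ {p q} → 0ℚ ≤ℚ p → 0ℚ < q → p * q ≡ 0ℚ → p ≡ 0ℚ
*-cancel-pos {p} {q} 0≤p 0<q pq≡0 = ℚ.≤-antisym
  (ℚ.*-cancelʳ-≤-pos q {{positive 0<q}} (ℚ.≤-reflexive (trans pq≡0 (sym (ℚ.*-zeroˡ q))))) 0≤p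

corners-faceToFace : ∀ s r x → InConv (corners s) x → InConv (corners r) x → InConv (corners s ∩ corners r) x
-- The weights from `s` are kept; only their support has to be narrowed.
corners-faceToFace s r x cs@(λs , 0≤λ , supp , Σλ≡1 , comb) cr = λs , 0≤λ , supp∩ , Σλ≡1 , comb
  where
  -- Each of the two forms is maximal at `x`, so the values agree and the total slack is zero.
  same : ⟨ piece s , x ⟩ - ⟨ piece r , x ⟩ ≡ 0ℚ
  same = ℚ.≤-antisym
    (subst (_≤ℚ 0ℚ) (neg-difference ⟨ piece r , x ⟩ ⟨ piece s , x ⟩)
      (ℚ.neg-antimono-≤ (piece-max r s cr)))
    (piece-max s r cs)
  term≡0 : ∀ v → λs v * (height v - ⟨ piece r , vertex v ⟩) ≡ 0ℚ
  term≡0 = summand-zero (gap-term-nonNeg s r cs) (trans (piece-gap s r cs) same)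
  supp∩ : ∀ v → v ∉ corners s ∩ corners r → λs v ≡ 0ℚ
  supp∩ v v∉∩ = cases (v ∈? corners s) (lower-hull r v)
    where
    cases : Dec (v ∈ corners s) → _ → λs v ≡ 0ℚ
    cases (no v∉s)  _               = supp v v∉s
    cases (yes v∈s) (inj₁ (v∈r , _)) = contradiction (x∈p∩q⁺ (v∈s , v∈r)) v∉∩
    -- A vertex outside `r` has positive slack, so its zero term forces a zero weight.
    cases (yes _)   (inj₂ (_ , lt)) = *-cancel-pos (0≤λ v) (<⇒0<- lt) (term≡0 v)

triangulation-isTriangulation : IsTriangulation triangulation
triangulation-isTriangulation =
    (triangulation-covers , λ _ _ _ → inConv⇒inP)
  , AllPairs.tabulate⁺ {f = simplex} (λ {s} {r} s≢r eq → s≢r (corners-injective s r eq))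
  , faceToFace
  where
  faceToFace : FaceToFace triangulation
  faceToFace σ τ σ∈T τ∈T with ∈-tabulate⁻ {f = simplex} σ∈T | ∈-tabulate⁻ {f = simplex} τ∈T
  ... | s , refl | r , refl = corners-faceToFace s r

theorem21 : ((C : List Simplex4) → IsCover C → 10 ≤ length C)
    × (Σ[ T ∈ List Simplex4 ] (IsTriangulation T × length T ≡ 10))
theorem21 = cover-size , triangulation , triangulation-isTriangulation , refl
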